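{- For every nonnegative integer $n$ let $$R_n=\sum_{k=0}^{n}\binom{n+k}{2k}\binom{2k}{k}\frac{1}{2k-1}.$$ Let $n$ be a positive integer and $p$ an odd prime. Then $$\sum_{k=0}^{n-1}(2k+1)R_k^2 \equiv 0 \pmod{n},$$ and $$\sum_{k=0}^{p-1}(2k+1)R_k^2 \equiv 4p(-1)^{\frac{p-1}{2}} -p^2 \pmod{p^3}.$$
   Context: For every nonnegative integer $k$, $\binom{2k}{k}\frac{1}{2k-1}$ is an integer, so each $R_n$ is an integer. -}

module Defs where

open import Data.Nat as ℕ using (ℕ; zero; suc)
open import Data.Nat.Combinatorics using (_C_)
open import Data.Integer as ℤ using (ℤ; +_; -[1+_])

sumBelow : ℕ → (ℕ → ℤ) → ℤ
sumBelow zero    f = + 0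
sumBelow (suc n) f = sumBelow n f ℤ.+ f n

-- binom(2k,k) / (2k-1) as an integer (exact division; for k = 0 it is 1/(-1) = -1)
centralOver : ℕ → ℤ
centralOver zero    = -[1+ 0 ]
centralOver (suc k) = + (((2 ℕ.* suc k) C (suc k)) ℕ./ (suc (2 ℕ.* k)))

R : ℕ → ℤ
R n = sumBelow (suc n) (λ k → + ((n ℕ.+ k) C (2 ℕ.* k)) ℤ.* centralOver k)

{-# OPTIONS --safe #-}
module Submission where

-- The coefficients c_k = binom(2k,k)/(2k-1) satisfy k c_k = 2 binom(2k-2,k-1) and c_k + binom(2k,k) = 2 k c_k.
-- Hence R_n + D_n = 4 T_n, where D_n = Σ_k binom(n+k,2k) binom(2k,k) are the central Delannoy numbers and
-- T_n = Σ_{k≥1} binom(n+k,2k) binom(2k-2,k-1), and the recurrences of binom(n+k,2k) in n give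
--   (n+1) (R_{n+1} - R_n) = 2 (T_n + T_{n+1})   and   T_{n+2} - 2 T_{n+1} + T_n = D_{n+1}.
-- By induction on n, W_n = T_0 + … + T_{n-1} satisfies 16 W_{n+1} = (n+1) (R_n + R_{n+1}), and then
--   Σ_{k≤n} (2k+1) R_k² = (n+1)² R_n² - 32 W_n W_{n+1} = (n+1) ((n+1) R_n² - 2 (R_n + R_{n+1}) W_n).
-- For n + 1 = p an odd prime, the last factor is determined modulo p² by T_n and D_n + D_{n+1} modulo p² and by D_n
-- modulo p.  Every term of these three sums is a rational multiple of some binom(p-1,j) binom(p+j,j), which is
-- congruent to (-1)^j modulo p².  In 2 T_n the multiple is ± p/(2j+1) modulo p²: the denominator 2j+1 = p gives the
-- sign (-1)^((p-1)/2), the denominator 1 gives -p, and the other denominators cancel in pairs with sum 2p.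

open import Defs
import Algebra.Properties.CommutativeSemigroup as CommutativeSemigroupProperties
open import Data.Integer as ℤ using (ℤ; +_; -[1+_]; _+_; _*_; _-_; -_; _^_)
open import Data.Integer.Coprimality using (Coprime; coprime-divisor) renaming (sym to coprime-sym)
open import Data.Integer.Divisibility using (_∣_)
open import Data.Integer.Divisibility.Signed using (divides; ∣⇒∣ᵤ; ∣ᵤ⇒∣)
open import Data.Integer.Properties
  using (+-assoc; +-comm; +-identityˡ; +-identityʳ; +-commutativeSemigroup; i≡j⇒i-j≡0; *-assoc; *-comm; *-identityˡ;
         *-identityʳ; *-zeroˡ; *-zeroʳ; *-distribˡ-+; *-distribʳ-+; *-cancelˡ-≡; *-commutativeSemigroup; suc-*;
         pos-*; abs-*; ^-distribˡ-+-*; ^-*-assoc; ^-zeroˡ)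
open import Data.Integer.Tactic.RingSolver using (solve; solve-∀)
open import Data.List using ([]; _∷_)
open import Data.Nat as ℕ using (ℕ; zero; suc; _∸_; z≤n; s≤s)
open import Data.Nat.Combinatorics using (_C_; nCk+nC[k+1]≡[n+1]C[k+1]; k>n⇒nCk≡0; nC1≡n)
import Data.Nat.Coprimality as ℕ
import Data.Nat.Divisibility as ℕ
open import Data.Nat.DivMod using (m/n*n≡m; m*n/n≡m; m≡m%n+[m/n]*n; m%n<n)
open import Data.Nat.Primality using (Prime; prime⇒irreducible; ¬prime[1])
import Data.Nat.Properties as ℕ
open import Data.Product using (_×_; _,_; ∃)
open import Data.Sum using (inj₂)
open import Level using (0ℓ)
open import Relation.Binary.Bundles using (Setoid)
open import Relation.Binary.PropositionalEquality
  using (_≡_; _≢_; refl; sym; trans; cong; cong₂; subst; module ≡-Reasoning)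
import Relation.Binary.Reasoning.Setoid as SetoidReasoning
open import Relation.Nullary using (contradiction)

open CommutativeSemigroupProperties +-commutativeSemigroup using (xy∙z≈x∙zy; xy∙z≈xz∙y)
  renaming (interchange to +-interchange)
open CommutativeSemigroupProperties *-commutativeSemigroup using (x∙yz≈y∙xz; x∙yz≈yx∙z; xy∙z≈y∙xz)
  renaming (interchange to *-interchange)

-- Finite sums

sumBelow-cong : ∀ n {f g} → (∀ k → f k ≡ g k) → sumBelow n f ≡ sumBelow n g
sumBelow-cong zero    f≗g = refl
sumBelow-cong (suc n) f≗g = cong₂ _+_ (sumBelow-cong n f≗g) (f≗g n)

sumBelow-+ : ∀ n f g → sumBelow n (λ k → f k + g k) ≡ sumBelow n f + sumBelow n g
sumBelow-+ zero    f g = refl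
sumBelow-+ (suc n) f g = begin
  sumBelow n (λ k → f k + g k) + (f n + g n)   ≡⟨ cong (_+ (f n + g n)) (sumBelow-+ n f g) ⟩
  sumBelow n f + sumBelow n g + (f n + g n)    ≡⟨ +-interchange (sumBelow n f) _ _ _ ⟩
  sumBelow n f + f n + (sumBelow n g + g n)    ∎
  where open ≡-Reasoning

sumBelow-* : ∀ n c f → sumBelow n (λ k → c * f k) ≡ c * sumBelow n f
sumBelow-* zero    c f = sym (*-zeroʳ c)
sumBelow-* (suc n) c f = begin
  sumBelow n (λ k → c * f k) + c * f n   ≡⟨ cong (_+ c * f n) (sumBelow-* n c f) ⟩
  c * sumBelow n f + c * f n             ≡⟨ *-distribˡ-+ c (sumBelow n f) (f n) ⟨
  c * (sumBelow n f + f n)               ∎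
  where open ≡-Reasoning

sumBelow-head : ∀ n f → sumBelow (suc n) f ≡ f 0 + sumBelow n (λ k → f (suc k))
sumBelow-head zero    f = trans (+-identityˡ (f 0)) (sym (+-identityʳ (f 0)))
sumBelow-head (suc n) f = begin
  sumBelow (suc n) f + f (suc n)                     ≡⟨ cong (_+ f (suc n)) (sumBelow-head n f) ⟩
  f 0 + sumBelow n (λ k → f (suc k)) + f (suc n)     ≡⟨ +-assoc (f 0) _ _ ⟩
  f 0 + (sumBelow n (λ k → f (suc k)) + f (suc n))   ∎
  where open ≡-Reasoning

sumBelow-extend : ∀ d {n f} → (∀ {k} → n ℕ.≤ k → f k ≡ + 0) → sumBelow (d ℕ.+ n) f ≡ sumBelow n f
sumBelow-extend zero        f≡0 = refl
sumBelow-extend (suc d) {n} f≡0 =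
  trans (cong₂ _+_ (sumBelow-extend d f≡0) (f≡0 (ℕ.m≤n+m n d))) (+-identityʳ _)

-- Congruences

infix 4 _≈_mod_

record _≈_mod_ (x y m : ℤ) : Set where
  constructor congruent
  field
    quotient : ℤ
    equality : x ≡ y + quotient * m

≈-refl : ∀ {m x} → x ≈ x mod m
≈-refl {m} {x} = congruent (+ 0) (solve (m ∷ x ∷ []))

≈-sym : ∀ {m x y} → x ≈ y mod m → y ≈ x mod m
≈-sym {m} {y = y} (congruent q refl) = congruent (- q) (solve (m ∷ y ∷ q ∷ []))

≈-trans : ∀ {m x y z} → x ≈ y mod m → y ≈ z mod m → x ≈ z mod m
≈-trans {m} {z = z} (congruent q refl) (congruent q′ refl) = congruent (q + q′) (solve (m ∷ z ∷ q ∷ q′ ∷ []))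

≈-setoid : ℤ → Setoid 0ℓ 0ℓ
≈-setoid m = record
  { Carrier       = ℤ
  ; _≈_           = λ x y → x ≈ y mod m
  ; isEquivalence = record { refl = ≈-refl ; sym = ≈-sym ; trans = ≈-trans }
  }

module ≈-Reasoning (m : ℤ) = SetoidReasoning (≈-setoid m)

+-cong : ∀ {m x y u v} → x ≈ y mod m → u ≈ v mod m → x + u ≈ y + v mod m
+-cong {m} {y = y} {v = v} (congruent q refl) (congruent q′ refl) =
  congruent (q + q′) (solve (m ∷ y ∷ v ∷ q ∷ q′ ∷ []))

+-congˡ : ∀ {m} x {u v} → u ≈ v mod m → x + u ≈ x + v mod m
+-congˡ x = +-cong (≈-refl {x = x})

-‿cong : ∀ {m x y} → x ≈ y mod m → - x ≈ - y mod m
-‿cong {m} {y = y} (congruent q refl) = congruent (- q) (solve (m ∷ y ∷ q ∷ []))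

*-cong : ∀ {m x y u v} → x ≈ y mod m → u ≈ v mod m → x * u ≈ y * v mod m
*-cong {m} {y = y} {v = v} (congruent q refl) (congruent q′ refl) =
  congruent (y * q′ + q * v + q * q′ * m) (solve (m ∷ y ∷ v ∷ q ∷ q′ ∷ []))

*-congˡ : ∀ {m} x {u v} → u ≈ v mod m → x * u ≈ x * v mod m
*-congˡ x = *-cong (≈-refl {x = x})

≈-scale : ∀ {m x y} c → x ≈ y mod m → c * x ≈ c * y mod c * m
≈-scale {m} {y = y} c (congruent q refl) = congruent q (solve (m ∷ y ∷ c ∷ q ∷ []))

≈-weaken : ∀ {m x y} c → x ≈ y mod c * m → x ≈ y mod m
≈-weaken {m} {y = y} c (congruent q refl) = congruent (q * c) (solve (m ∷ y ∷ c ∷ q ∷ []))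

≈⇒∣- : ∀ {m x y} → x ≈ y mod m → m ∣ x - y
≈⇒∣- {m} {y = y} (congruent q refl) = ∣⇒∣ᵤ {m} {y + q * m - y} (divides q (solve (m ∷ y ∷ q ∷ [])))

∣-⇒≈ : ∀ {m} x y → m ∣ x - y → x ≈ y mod m
∣-⇒≈ x y m∣x-y with divides q x-y≡qm ← ∣ᵤ⇒∣ m∣x-y =
  congruent q (trans (add-subtract x y) (cong (λ i → y + i) x-y≡qm))
  where
  add-subtract : ∀ x y → x ≡ y + (x - y)
  add-subtract = solve-∀

≈-cancelˡ : ∀ {m} c {x y} → Coprime m c → c * x ≈ c * y mod m → x ≈ y mod m
≈-cancelˡ {m} c {x} {y} m⊥c cx≈cy =
  ∣-⇒≈ x y (coprime-divisor m c (x - y) m⊥c (subst (m ∣_) (factor c x y) (≈⇒∣- cx≈cy)))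
  where
  factor : ∀ c x y → c * x - c * y ≡ c * (x - y)
  factor = solve-∀

coprime-*ˡ : ∀ i j k → Coprime i k → Coprime j k → Coprime (i * j) k
coprime-*ˡ i j k i⊥k j⊥k = subst (λ z → ℕ.Coprime z ℤ.∣ k ∣) (sym (abs-* i j)) ∣i∣∣j∣⊥∣k∣
  where
  ∣i∣∣j∣⊥∣k∣ : ℕ.Coprime (ℤ.∣ i ∣ ℕ.* ℤ.∣ j ∣) ℤ.∣ k ∣
  ∣i∣∣j∣⊥∣k∣ (d∣ij , d∣k) = j⊥k (ℕ.coprime-divisor (λ (e∣d , e∣i) → i⊥k (e∣i , ℕ.∣-trans e∣d d∣k)) d∣ij , d∣k)

coprime-*ʳ : ∀ i j k → Coprime i j → Coprime i k → Coprime i (j * k)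
coprime-*ʳ i j k i⊥j i⊥k =
  coprime-sym {j * k} {i} (coprime-*ˡ j k i (coprime-sym {i} {j} i⊥j) (coprime-sym {i} {k} i⊥k))

sumBelow-≈0 : ∀ {m} n {f} → (∀ {k} → k ℕ.< n → f k ≈ + 0 mod m) → sumBelow n f ≈ + 0 mod m
sumBelow-≈0 zero    f≈0 = ≈-refl
sumBelow-≈0 (suc n) f≈0 = +-cong (sumBelow-≈0 n (λ k<n → f≈0 (ℕ.m<n⇒m<1+n k<n))) (f≈0 (ℕ.n<1+n n))

sumBelow-pairs-cancel : ∀ {d} m f → (∀ i j → i ℕ.+ j ≡ 2 ℕ.* m → i ℕ.< m → f i + f j ≈ + 0 mod d) →
                        sumBelow (suc (2 ℕ.* m)) f ≈ f m mod d
sumBelow-pairs-cancel {d} zero    f pair≈0 = begin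
  + 0 + f 0   ≡⟨ +-identityˡ (f 0) ⟩
  f 0         ∎
  where open ≈-Reasoning d
sumBelow-pairs-cancel {d} (suc m) f pair≈0 = begin
  sumBelow (suc (2 ℕ.* suc m)) f          ≡⟨ cong (λ n → sumBelow (suc n) f) 2[m+1] ⟩
  sumBelow (suc last) f                   ≡⟨ cong (_+ f last) (sumBelow-head (suc (2 ℕ.* m)) f) ⟩
  f 0 + inner + f last                    ≡⟨ xy∙z≈xz∙y (f 0) inner (f last) ⟩
  f 0 + f last + inner                    ≈⟨ +-cong (pair≈0 0 last (sym 2[m+1]) (s≤s z≤n)) inner≈ ⟩
  + 0 + f (suc m)                         ≡⟨ +-identityˡ (f (suc m)) ⟩
  f (suc m)                               ∎
  where
  open ≈-Reasoning d
  last : ℕ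
  last = 2 ℕ.+ 2 ℕ.* m
  2[m+1] : 2 ℕ.* suc m ≡ last
  2[m+1] = ℕ.*-suc 2 m
  inner : ℤ
  inner = sumBelow (suc (2 ℕ.* m)) (λ k → f (suc k))
  inner≈ : inner ≈ f (suc m) mod d
  inner≈ = sumBelow-pairs-cancel m (λ k → f (suc k)) λ i j i+j≡2m i<m →
    pair≈0 (suc i) (suc j) (trans (cong suc (trans (ℕ.+-suc i j) (cong suc i+j≡2m))) (sym 2[m+1])) (s≤s i<m)

-- Since p divides y, the congruence a ≡ -b modulo p gives a y ≡ -b y modulo p².
module _ (p a b s x y : ℤ) (p⊥a : Coprime p a) (a+b≡2p : a + b ≡ + 2 * p)
         (ax≈-ps : a * x ≈ - (p * s) mod p * p) (by≈-ps : b * y ≈ - (p * s) mod p * p) where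
  private
    y≈0 : y ≈ + 0 mod p
    y≈0 = ≈-cancelˡ a p⊥a (begin
      a * y                           ≡⟨ solve (a ∷ b ∷ y ∷ []) ⟩
      (a + b) * y - b * y             ≡⟨ cong (λ i → i * y - b * y) a+b≡2p ⟩
      + 2 * p * y - b * y             ≈⟨ congruent (+ 2 * y) (solve (p ∷ b ∷ y ∷ [])) ⟩
      - (b * y)                       ≈⟨ -‿cong (≈-weaken p by≈-ps) ⟩
      - - (p * s)                     ≈⟨ congruent s (solve (a ∷ p ∷ s ∷ [])) ⟩
      a * + 0                         ∎)
      where open ≈-Reasoning p

  opposite-denominators-cancel : x + y ≈ + 0 mod p * p
  opposite-denominators-cancel = ≈-cancelˡ a (coprime-*ˡ p p a p⊥a p⊥a) (begin
    a * (x + y)                                  ≡⟨ solve (a ∷ b ∷ x ∷ y ∷ []) ⟩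
    a * x - b * y + (a + b) * y                  ≡⟨ cong (λ i → a * x - b * y + i * y) a+b≡2p ⟩
    a * x - b * y + + 2 * p * y                  ≡⟨ cong (λ i → a * x - b * y + i) (*-assoc (+ 2) p y) ⟩
    a * x - b * y + + 2 * (p * y)
      ≈⟨ +-cong (+-cong ax≈-ps (-‿cong by≈-ps)) (*-congˡ (+ 2) (≈-scale p y≈0)) ⟩
    - (p * s) - - (p * s) + + 2 * (p * + 0)      ≡⟨ solve (p ∷ s ∷ a ∷ []) ⟩
    a * + 0                                      ∎)
    where open ≈-Reasoning (p * p)

altSign : ℕ → ℤ
altSign k = -[1+ 0 ] ^ k

altSign-double : ∀ m → altSign (2 ℕ.* m) ≡ + 1
altSign-double m = trans (sym (^-*-assoc -[1+ 0 ] 2 m)) (^-zeroˡ m)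

altSign-square : ∀ m → altSign m * altSign m ≡ + 1
altSign-square m = begin
  altSign m * altSign m      ≡⟨ ^-distribˡ-+-* -[1+ 0 ] m m ⟨
  altSign (m ℕ.+ m)          ≡⟨ cong (λ k → altSign (m ℕ.+ k)) (ℕ.+-identityʳ m) ⟨
  altSign (2 ℕ.* m)          ≡⟨ altSign-double m ⟩
  + 1                        ∎
  where open ≡-Reasoning

altSign-reflect : ∀ i j m → i ℕ.+ j ≡ 2 ℕ.* m → altSign i ≡ altSign j
altSign-reflect i j m i+j≡2m = begin
  altSign i                              ≡⟨ *-identityʳ (altSign i) ⟨
  altSign i * + 1                        ≡⟨ cong (altSign i *_) (altSign-square j) ⟨
  altSign i * (altSign j * altSign j)    ≡⟨ *-assoc (altSign i) (altSign j) (altSign j) ⟨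
  altSign i * altSign j * altSign j      ≡⟨ cong (_* altSign j) (^-distribˡ-+-* -[1+ 0 ] i j) ⟨
  altSign (i ℕ.+ j) * altSign j          ≡⟨ cong (λ k → altSign k * altSign j) i+j≡2m ⟩
  altSign (2 ℕ.* m) * altSign j          ≡⟨ cong (_* altSign j) (altSign-double m) ⟩
  + 1 * altSign j                        ≡⟨ *-identityˡ (altSign j) ⟩
  altSign j                              ∎
  where open ≡-Reasoning

-- Binomial coefficients

binom : ℕ → ℕ → ℤ
binom n k = + (n C k)

binom-vanish : ∀ {n k} → n ℕ.< k → binom n k ≡ + 0
binom-vanish n<k = cong +_ (k>n⇒nCk≡0 n<k)

pascal : ∀ n k → binom (suc n) (suc k) ≡ binom n k + binom n (suc k)
pascal n k = cong +_ (sym (nCk+nC[k+1]≡[n+1]C[k+1] n k))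

binom-suc-suc : ∀ n k → + suc k * binom (suc n) (suc k) ≡ + suc n * binom n k
binom-suc-suc n       zero    = begin
  + 1 * binom (suc n) 1   ≡⟨ *-identityˡ (binom (suc n) 1) ⟩
  binom (suc n) 1         ≡⟨ cong +_ (nC1≡n (suc n)) ⟩
  + suc n                 ≡⟨ *-identityʳ (+ suc n) ⟨
  + suc n * + 1           ∎
  where open ≡-Reasoning
binom-suc-suc zero    (suc k) = *-zeroʳ (+ suc (suc k))
binom-suc-suc (suc n) (suc k) = begin
  + suc (suc k) * binom (suc (suc n)) (suc (suc k))      ≡⟨ cong (+ suc (suc k) *_) (pascal (suc n) (suc k)) ⟩
  + suc (suc k) * (x + y)                                ≡⟨ split (+ k) x y ⟩
  x + (+ suc k * x + + suc (suc k) * y)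
    ≡⟨ cong (λ i → x + i) (cong₂ _+_ (binom-suc-suc n k) (binom-suc-suc n (suc k))) ⟩
  x + (+ suc n * binom n k + + suc n * binom n (suc k))
    ≡⟨ cong (λ i → x + i) (*-distribˡ-+ (+ suc n) (binom n k) (binom n (suc k))) ⟨
  x + + suc n * (binom n k + binom n (suc k))            ≡⟨ cong (λ i → x + + suc n * i) (pascal n k) ⟨
  x + + suc n * x                                        ≡⟨ suc-* (+ suc n) x ⟨
  + suc (suc n) * x                                      ∎
  where
  open ≡-Reasoning
  x y : ℤ
  x = binom (suc n) (suc k)
  y = binom (suc n) (suc (suc k))
  split : ∀ k x y → (+ 2 + k) * (x + y) ≡ x + ((+ 1 + k) * x + (+ 2 + k) * y)
  split = solve-∀

binom-sucʳ : ∀ n k → + suc k * binom n (suc k) ≡ (+ n - + k) * binom n k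
binom-sucʳ n k = begin
  + suc k * binom n (suc k)                              ≡⟨ add-subtract (+ suc k) x _ ⟩
  + suc k * (x + binom n (suc k)) - + suc k * x          ≡⟨ cong (λ i → + suc k * i - + suc k * x) (pascal n k) ⟨
  + suc k * binom (suc n) (suc k) - + suc k * x          ≡⟨ cong (_- + suc k * x) (binom-suc-suc n k) ⟩
  + suc n * x - + suc k * x                              ≡⟨ factor (+ n) (+ k) x ⟩
  (+ n - + k) * x                                        ∎
  where
  open ≡-Reasoning
  x : ℤ
  x = binom n k
  add-subtract : ∀ c x y → c * y ≡ c * (x + y) - c * x
  add-subtract = solve-∀
  factor : ∀ n k x → (+ 1 + n) * x - (+ 1 + k) * x ≡ (n - k) * x
  factor = solve-∀

binom-sucˡ : ∀ n k → (+ suc n - + k) * binom (suc n) k ≡ + suc n * binom n k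
binom-sucˡ n k = trans (sym (binom-sucʳ (suc n) k)) (binom-suc-suc n k)

binom-second-difference : ∀ n k → binom (2 ℕ.+ n) (2 ℕ.+ k) + binom n (2 ℕ.+ k) ≡
                                  + 2 * binom (suc n) (2 ℕ.+ k) + binom n k
binom-second-difference n k = begin
  binom (2 ℕ.+ n) (2 ℕ.+ k) + z           ≡⟨ cong (_+ z) (pascal (suc n) (suc k)) ⟩
  binom (suc n) (suc k) + w + z           ≡⟨ cong (λ i → i + w + z) (pascal n k) ⟩
  x + y + w + z                           ≡⟨ regroup x y z w ⟩
  w + (y + z) + x                         ≡⟨ cong (λ i → w + i + x) (pascal n (suc k)) ⟨
  w + w + x                               ≡⟨ cong (_+ x) (double w) ⟩
  + 2 * w + x                             ∎
  where
  open ≡-Reasoning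
  x y z w : ℤ
  x = binom n k
  y = binom n (suc k)
  z = binom n (2 ℕ.+ k)
  w = binom (suc n) (2 ℕ.+ k)
  regroup : ∀ x y z w → x + y + w + z ≡ w + (y + z) + x
  regroup = solve-∀
  double : ∀ w → w + w ≡ + 2 * w
  double = solve-∀

trinomial-revision : ∀ k n m → binom (k ℕ.+ n) (k ℕ.+ m) * binom (k ℕ.+ m) k ≡ binom (k ℕ.+ n) k * binom n m
trinomial-revision zero    n m = *-comm (binom n m) (+ 1)
trinomial-revision (suc k) n m = *-cancelˡ-≡ K _ _ (begin
  K * (x′ * y′)     ≡⟨ x∙yz≈y∙xz K x′ y′ ⟩
  x′ * (K * y′)     ≡⟨ cong (x′ *_) (binom-suc-suc (k ℕ.+ m) k) ⟩
  x′ * (M * y)      ≡⟨ x∙yz≈yx∙z x′ M y ⟩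
  M * x′ * y        ≡⟨ cong (_* y) (binom-suc-suc (k ℕ.+ n) (k ℕ.+ m)) ⟩
  N * x * y         ≡⟨ *-assoc N x y ⟩
  N * (x * y)       ≡⟨ cong (N *_) (trinomial-revision k n m) ⟩
  N * (z * w)       ≡⟨ *-assoc N z w ⟨
  N * z * w         ≡⟨ cong (_* w) (binom-suc-suc (k ℕ.+ n) k) ⟨
  K * z′ * w        ≡⟨ *-assoc K z′ w ⟩
  K * (z′ * w)      ∎)
  where
  open ≡-Reasoning
  K M N x x′ y y′ z z′ w : ℤ
  K = + suc k
  M = + suc (k ℕ.+ m)
  N = + suc (k ℕ.+ n)
  x  = binom (k ℕ.+ n) (k ℕ.+ m)
  x′ = binom (suc k ℕ.+ n) (suc k ℕ.+ m)
  y  = binom (k ℕ.+ m) k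
  y′ = binom (suc k ℕ.+ m) (suc k)
  z  = binom (k ℕ.+ n) k
  z′ = binom (suc k ℕ.+ n) (suc k)
  w  = binom n m

central : ℕ → ℤ
central k = binom (2 ℕ.* k) k

odd : ℕ → ℤ
odd k = + 1 + + 2 * + k

pos-odd : ∀ k → + suc (2 ℕ.* k) ≡ odd k
pos-odd k = cong ℤ.suc (pos-* 2 k)

central-suc : ∀ k → + suc k * central (suc k) ≡ + 2 * (odd k * central k)
central-suc k = *-cancelˡ-≡ K _ _ (begin
  K * (K * central (suc k))
    ≡⟨ cong (λ i → K * (K * binom i (suc k))) (ℕ.*-suc 2 k) ⟩
  K * (K * binom (2 ℕ.+ 2 ℕ.* k) (suc k))
    ≡⟨ cong (K *_) (binom-suc-suc (suc (2 ℕ.* k)) k) ⟩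
  K * (+ (2 ℕ.+ 2 ℕ.* k) * binom (suc (2 ℕ.* k)) k)
    ≡⟨ split (+ k) (binom (suc (2 ℕ.* k)) k) ⟩
  + 2 * (K * ((+ suc (2 ℕ.* k) - + k) * binom (suc (2 ℕ.* k)) k))
    ≡⟨ cong (λ i → + 2 * (K * i)) (binom-sucˡ (2 ℕ.* k) k) ⟩
  + 2 * (K * (+ suc (2 ℕ.* k) * central k))
    ≡⟨ regroup (+ k) (central k) ⟩
  K * (+ 2 * (odd k * central k)) ∎)
  where
  open ≡-Reasoning
  K : ℤ
  K = + suc k
  split : ∀ k x → (+ 1 + k) * ((+ 2 + (k + (k + + 0))) * x) ≡ + 2 * ((+ 1 + k) * ((+ 1 + (k + (k + + 0)) - k) * x))
  split = solve-∀
  regroup : ∀ k x → + 2 * ((+ 1 + k) * ((+ 1 + (k + (k + + 0))) * x)) ≡ (+ 1 + k) * (+ 2 * ((+ 1 + + 2 * k) * x))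
  regroup = solve-∀

1+2k∣central : ∀ k → suc (2 ℕ.* k) ℕ.∣ ((2 ℕ.* suc k) C suc k)
1+2k∣central k = ∣⇒∣ᵤ {+ suc (2 ℕ.* k)} {c′} (divides (+ 4 * c - c′) (begin
  c′                                        ≡⟨ unit-combination (+ k) c′ ⟩
  + 2 * (+ suc k * c′) - odd k * c′         ≡⟨ cong (λ i → + 2 * i - odd k * c′) (central-suc k) ⟩
  + 2 * (+ 2 * (odd k * c)) - odd k * c′    ≡⟨ factor (odd k) c c′ ⟩
  (+ 4 * c - c′) * odd k                    ≡⟨ cong (λ i → (+ 4 * c - c′) * i) (pos-odd k) ⟨
  (+ 4 * c - c′) * + suc (2 ℕ.* k)          ∎))
  where
  open ≡-Reasoning
  c c′ : ℤ
  c = central k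
  c′ = central (suc k)
  unit-combination : ∀ k c′ → c′ ≡ + 2 * ((+ 1 + k) * c′) - (+ 1 + + 2 * k) * c′
  unit-combination = solve-∀
  factor : ∀ o c c′ → + 2 * (+ 2 * (o * c)) - o * c′ ≡ (+ 4 * c - c′) * o
  factor = solve-∀

centralOver-suc : ∀ k → odd k * centralOver (suc k) ≡ central (suc k)
centralOver-suc k = begin
  odd k * centralOver (suc k)                   ≡⟨ *-comm (odd k) (centralOver (suc k)) ⟩
  centralOver (suc k) * odd k                   ≡⟨ cong (centralOver (suc k) *_) (pos-odd k) ⟨
  centralOver (suc k) * + suc (2 ℕ.* k)         ≡⟨ pos-* (c′ ℕ./ suc (2 ℕ.* k)) (suc (2 ℕ.* k)) ⟨
  + (c′ ℕ./ suc (2 ℕ.* k) ℕ.* suc (2 ℕ.* k))    ≡⟨ cong +_ (m/n*n≡m (1+2k∣central k)) ⟩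
  central (suc k)                               ∎
  where
  open ≡-Reasoning
  c′ : ℕ
  c′ = (2 ℕ.* suc k) C suc k

-- The transform a ↦ Σ_k binom(n+k,2k) a_k

morganVoyce : ℕ → ℕ → ℤ
morganVoyce n k = binom (n ℕ.+ k) (2 ℕ.* k)

morganVoyce-vanish : ∀ {n k} → n ℕ.< k → morganVoyce n k ≡ + 0
morganVoyce-vanish {n} {k} n<k = binom-vanish {n ℕ.+ k} {2 ℕ.* k}
  (ℕ.+-mono-<-≤ n<k (ℕ.≤-reflexive (sym (ℕ.+-identityʳ k))))

morganVoyce-sucˡ : ∀ n k → (+ suc n - + k) * morganVoyce (suc n) k ≡ (+ suc n + + k) * morganVoyce n k
morganVoyce-sucˡ n k = begin
  (+ suc n - + k) * morganVoyce (suc n) k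
    ≡⟨ cong (_* morganVoyce (suc n) k) (add-subtract (+ n) (+ k)) ⟩
  (+ suc (n ℕ.+ k) - + (2 ℕ.* k)) * morganVoyce (suc n) k
    ≡⟨ binom-sucˡ (n ℕ.+ k) (2 ℕ.* k) ⟩
  (+ suc n + + k) * morganVoyce n k ∎
  where
  open ≡-Reasoning
  add-subtract : ∀ n k → + 1 + n - k ≡ + 1 + (n + k) - (k + (k + + 0))
  add-subtract = solve-∀

morganVoyce-second-difference : ∀ n k → morganVoyce (2 ℕ.+ n) (suc k) + morganVoyce n (suc k) ≡
                                        + 2 * morganVoyce (suc n) (suc k) + morganVoyce (suc n) k
morganVoyce-second-difference n k = begin
  morganVoyce (2 ℕ.+ n) (suc k) + morganVoyce n (suc k)
    ≡⟨ cong₂ _+_ (morganVoyce-sucʳ (2 ℕ.+ n)) (morganVoyce-sucʳ n) ⟩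
  binom (3 ℕ.+ n ℕ.+ k) (2 ℕ.+ 2 ℕ.* k) + binom (suc (n ℕ.+ k)) (2 ℕ.+ 2 ℕ.* k)
    ≡⟨ binom-second-difference (suc (n ℕ.+ k)) (2 ℕ.* k) ⟩
  + 2 * binom (2 ℕ.+ n ℕ.+ k) (2 ℕ.+ 2 ℕ.* k) + morganVoyce (suc n) k
    ≡⟨ cong (λ i → + 2 * i + morganVoyce (suc n) k) (morganVoyce-sucʳ (suc n)) ⟨
  + 2 * morganVoyce (suc n) (suc k) + morganVoyce (suc n) k ∎
  where
  open ≡-Reasoning
  morganVoyce-sucʳ : ∀ n → morganVoyce n (suc k) ≡ binom (suc (n ℕ.+ k)) (2 ℕ.+ 2 ℕ.* k)
  morganVoyce-sucʳ n = cong₂ binom (ℕ.+-suc n k) (ℕ.*-suc 2 k)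

transform : (ℕ → ℤ) → ℕ → ℤ
transform a n = sumBelow (suc n) (λ k → morganVoyce n k * a k)

transform-extend : ∀ a d n → sumBelow (d ℕ.+ suc n) (λ k → morganVoyce n k * a k) ≡ transform a n
transform-extend a d n =
  sumBelow-extend d (λ {k} n<k → trans (cong (_* a k) (morganVoyce-vanish n<k)) (*-zeroˡ (a k)))

transform-cong : ∀ {a b} → (∀ k → a k ≡ b k) → ∀ n → transform a n ≡ transform b n
transform-cong a≗b n = sumBelow-cong (suc n) (λ k → cong (morganVoyce n k *_) (a≗b k))

transform-+ : ∀ a b n → transform (λ k → a k + b k) n ≡ transform a n + transform b n
transform-+ a b n = trans
  (sumBelow-cong (suc n) (λ k → *-distribˡ-+ (morganVoyce n k) (a k) (b k)))
  (sumBelow-+ (suc n) _ _)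

transform-* : ∀ c a n → transform (λ k → c * a k) n ≡ c * transform a n
transform-* c a n = trans
  (sumBelow-cong (suc n) (λ k → x∙yz≈y∙xz (morganVoyce n k) c (a k)))
  (sumBelow-* (suc n) c _)

transform-difference : ∀ a n → + suc n * transform a (suc n) ≡
  + suc n * transform a n + (transform (λ k → + k * a k) n + transform (λ k → + k * a k) (suc n))
transform-difference a n = begin
  N * sumBelow bound (f (suc n))
    ≡⟨ sumBelow-* bound N (f (suc n)) ⟨
  sumBelow bound (λ k → N * f (suc n) k)
    ≡⟨ sumBelow-cong bound termwise ⟩
  sumBelow bound (λ k → N * f n k + (g n k + g (suc n) k))
    ≡⟨ sumBelow-+ bound _ _ ⟩
  sumBelow bound (λ k → N * f n k) + sumBelow bound (λ k → g n k + g (suc n) k)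
    ≡⟨ cong₂ _+_ (sumBelow-* bound N (f n)) (sumBelow-+ bound (g n) (g (suc n))) ⟩
  N * sumBelow bound (f n) + (sumBelow bound (g n) + sumBelow bound (g (suc n)))
    ≡⟨ cong₂ (λ x y → N * x + (y + sumBelow bound (g (suc n)))) (transform-extend a 1 n) (transform-extend _ 1 n) ⟩
  N * transform a n + (transform (λ k → + k * a k) n + transform (λ k → + k * a k) (suc n)) ∎
  where
  open ≡-Reasoning
  bound : ℕ
  bound = suc (suc n)
  N : ℤ
  N = + suc n
  f g : ℕ → ℕ → ℤ
  f n k = morganVoyce n k * a k
  g n k = morganVoyce n k * (+ k * a k)
  distribute : ∀ N k c x x′ → (N - k) * x′ ≡ (N + k) * x → N * (x′ * c) ≡ N * (x * c) + (x * (k * c) + x′ * (k * c))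
  distribute N k c x x′ ratio = begin
    N * (x′ * c)                                   ≡⟨ solve (N ∷ k ∷ c ∷ x′ ∷ []) ⟩
    (N - k) * x′ * c + x′ * (k * c)                ≡⟨ cong (λ i → i * c + x′ * (k * c)) ratio ⟩
    (N + k) * x * c + x′ * (k * c)                 ≡⟨ solve (N ∷ k ∷ c ∷ x ∷ x′ ∷ []) ⟩
    N * (x * c) + (x * (k * c) + x′ * (k * c))     ∎
  termwise : ∀ k → N * f (suc n) k ≡ N * f n k + (g n k + g (suc n) k)
  termwise k = distribute N (+ k) (a k) (morganVoyce n k) (morganVoyce (suc n) k) (morganVoyce-sucˡ n k)

delay : (ℕ → ℤ) → ℕ → ℤ
delay a zero    = + 0
delay a (suc k) = a k

transform-delay : ∀ a d n → sumBelow (d ℕ.+ n) (λ k → morganVoyce n (suc k) * a k) ≡ transform (delay a) n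
transform-delay a d n = begin
  sumBelow (d ℕ.+ n) (λ k → morganVoyce n (suc k) * a k)
    ≡⟨ sumBelow-extend d (λ {k} n≤k → trans (cong (_* a k) (morganVoyce-vanish (s≤s n≤k))) (*-zeroˡ (a k))) ⟩
  sumBelow n (λ k → morganVoyce n (suc k) * a k)
    ≡⟨ +-identityˡ _ ⟨
  + 0 + sumBelow n (λ k → morganVoyce n (suc k) * a k)
    ≡⟨ sumBelow-head n (λ k → morganVoyce n k * delay a k) ⟨
  transform (delay a) n ∎
  where open ≡-Reasoning

transform-delay-second-difference : ∀ a n →
  transform (delay a) (2 ℕ.+ n) + transform (delay a) n ≡ + 2 * transform (delay a) (suc n) + transform a (suc n)
transform-delay-second-difference a n = begin
  transform (delay a) (2 ℕ.+ n) + transform (delay a) n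
    ≡⟨ cong₂ _+_ (transform-delay a 0 (2 ℕ.+ n)) (transform-delay a 2 n) ⟨
  sumBelow bound (f (2 ℕ.+ n)) + sumBelow bound (f n)
    ≡⟨ sumBelow-+ bound (f (2 ℕ.+ n)) (f n) ⟨
  sumBelow bound (λ k → f (2 ℕ.+ n) k + f n k)
    ≡⟨ sumBelow-cong bound termwise ⟩
  sumBelow bound (λ k → + 2 * f (suc n) k + morganVoyce (suc n) k * a k)
    ≡⟨ sumBelow-+ bound _ _ ⟩
  sumBelow bound (λ k → + 2 * f (suc n) k) + transform a (suc n)
    ≡⟨ cong (_+ transform a (suc n)) (sumBelow-* bound (+ 2) (f (suc n))) ⟩
  + 2 * sumBelow bound (f (suc n)) + transform a (suc n)
    ≡⟨ cong (λ x → + 2 * x + transform a (suc n)) (transform-delay a 1 (suc n)) ⟩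
  + 2 * transform (delay a) (suc n) + transform a (suc n) ∎
  where
  open ≡-Reasoning
  bound : ℕ
  bound = 2 ℕ.+ n
  f : ℕ → ℕ → ℤ
  f n k = morganVoyce n (suc k) * a k
  distribute : ∀ c x y z w → x + y ≡ + 2 * z + w → x * c + y * c ≡ + 2 * (z * c) + w * c
  distribute c x y z w x+y≡2z+w = begin
    x * c + y * c            ≡⟨ *-distribʳ-+ c x y ⟨
    (x + y) * c              ≡⟨ cong (_* c) x+y≡2z+w ⟩
    (+ 2 * z + w) * c        ≡⟨ solve (c ∷ z ∷ w ∷ []) ⟩
    + 2 * (z * c) + w * c    ∎
  termwise : ∀ k → f (2 ℕ.+ n) k + f n k ≡ + 2 * f (suc n) k + morganVoyce (suc n) k * a k
  termwise k = distribute (a k) (morganVoyce (2 ℕ.+ n) (suc k)) (morganVoyce n (suc k))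
    (morganVoyce (suc n) (suc k)) (morganVoyce (suc n) k) (morganVoyce-second-difference n k)

-- Recurrences and the closed form of the sum

k*centralOver : ∀ k → + k * centralOver k ≡ + 2 * delay central k
k*centralOver zero    = refl
k*centralOver (suc k) = *-cancelˡ-≡ (+ suc (2 ℕ.* k)) _ _ (begin
  + suc (2 ℕ.* k) * (+ suc k * c)        ≡⟨ cong (_* (+ suc k * c)) (pos-odd k) ⟩
  odd k * (+ suc k * c)                  ≡⟨ x∙yz≈y∙xz (odd k) (+ suc k) c ⟩
  + suc k * (odd k * c)                  ≡⟨ cong (+ suc k *_) (centralOver-suc k) ⟩
  + suc k * central (suc k)              ≡⟨ central-suc k ⟩
  + 2 * (odd k * central k)              ≡⟨ x∙yz≈y∙xz (+ 2) (odd k) (central k) ⟩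
  odd k * (+ 2 * central k)              ≡⟨ cong (_* (+ 2 * central k)) (pos-odd k) ⟨
  + suc (2 ℕ.* k) * (+ 2 * central k)    ∎)
  where
  open ≡-Reasoning
  c : ℤ
  c = centralOver (suc k)

centralOver+central : ∀ k → centralOver k + central k ≡ + 4 * delay central k
centralOver+central zero    = refl
centralOver+central (suc k) = begin
  c + central (suc k)        ≡⟨ cong (λ i → c + i) (centralOver-suc k) ⟨
  c + odd k * c              ≡⟨ collect (+ k) c ⟩
  + 2 * (+ suc k * c)        ≡⟨ cong (+ 2 *_) (k*centralOver (suc k)) ⟩
  + 2 * (+ 2 * central k)    ≡⟨ *-assoc (+ 2) (+ 2) (central k) ⟨
  + 4 * central k            ∎
  where
  open ≡-Reasoning
  c : ℤ
  c = centralOver (suc k)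
  collect : ∀ k c → c + (+ 1 + + 2 * k) * c ≡ + 2 * ((+ 1 + k) * c)
  collect = solve-∀

D T S : ℕ → ℤ
D = transform central
T = transform (delay central)
S n = sumBelow n (λ k → + (2 ℕ.* k ℕ.+ 1) * (R k ^ 2))

R+D≡4T : ∀ n → R n + D n ≡ + 4 * T n
R+D≡4T n = begin
  transform centralOver n + transform central n    ≡⟨ transform-+ centralOver central n ⟨
  transform (λ k → centralOver k + central k) n    ≡⟨ transform-cong centralOver+central n ⟩
  transform (λ k → + 4 * delay central k) n        ≡⟨ transform-* (+ 4) (delay central) n ⟩
  + 4 * T n                                        ∎
  where open ≡-Reasoning

R-difference : ∀ n → + suc n * (R (suc n) - R n) ≡ + 2 * (T n + T (suc n))
R-difference n = begin
  N * (R (suc n) - R n)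
    ≡⟨ distrib N (R (suc n)) (R n) ⟩
  N * R (suc n) - N * R n
    ≡⟨ cong (_- N * R n) (transform-difference centralOver n) ⟩
  N * R n + (transform (λ k → + k * centralOver k) n + transform (λ k → + k * centralOver k) (suc n)) - N * R n
    ≡⟨ cong₂ (λ x y → N * R n + (x + y) - N * R n) (weighted n) (weighted (suc n)) ⟩
  N * R n + (+ 2 * T n + + 2 * T (suc n)) - N * R n
    ≡⟨ cancel (N * R n) (T n) (T (suc n)) ⟩
  + 2 * (T n + T (suc n)) ∎
  where
  open ≡-Reasoning
  N : ℤ
  N = + suc n
  weighted : ∀ n → transform (λ k → + k * centralOver k) n ≡ + 2 * T n
  weighted n = trans (transform-cong k*centralOver n) (transform-* (+ 2) (delay central) n)
  distrib : ∀ c x y → c * (x - y) ≡ c * x - c * y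
  distrib = solve-∀
  cancel : ∀ x t t′ → x + (+ 2 * t + + 2 * t′) - x ≡ + 2 * (t + t′)
  cancel = solve-∀

T-recurrence : ∀ n → T (2 ℕ.+ n) + T n + R (suc n) ≡ + 6 * T (suc n)
T-recurrence n = begin
  T (2 ℕ.+ n) + T n + R (suc n)
    ≡⟨ cong (_+ R (suc n)) (transform-delay-second-difference central n) ⟩
  + 2 * T (suc n) + D (suc n) + R (suc n)      ≡⟨ xy∙z≈x∙zy (+ 2 * T (suc n)) (D (suc n)) (R (suc n)) ⟩
  + 2 * T (suc n) + (R (suc n) + D (suc n))    ≡⟨ cong (λ i → + 2 * T (suc n) + i) (R+D≡4T (suc n)) ⟩
  + 2 * T (suc n) + + 4 * T (suc n)            ≡⟨ *-distribʳ-+ (T (suc n)) (+ 2) (+ 4) ⟨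
  + 6 * T (suc n)                              ∎
  where open ≡-Reasoning

sumBelow-T : ∀ n → + 16 * sumBelow (suc n) T ≡ + suc n * (R n + R (suc n))
sumBelow-T zero    = refl
sumBelow-T (suc n) = begin
  + 16 * (w + t′)                              ≡⟨ isolate w t′ ⟩
  + 16 * w + + 4 * t′ + + 2 * (+ 6 * t′)       ≡⟨ cong (λ i → + 16 * w + + 4 * t′ + + 2 * i) (T-recurrence n) ⟨
  + 16 * w + + 4 * t′ + + 2 * (t″ + t + r′)    ≡⟨ pair-up w t t′ t″ r′ ⟩
  + 16 * w + (+ 2 * (t + t′) + + 2 * (t′ + t″)) + + 2 * r′
    ≡⟨ cong₂ (λ i j → i + j + + 2 * r′) (sumBelow-T n) (sym (cong₂ _+_ (R-difference n) (R-difference (suc n)))) ⟩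
  + suc n * (r + r′) + (+ suc n * (r′ - r) + + suc (suc n) * (r″ - r′)) + + 2 * r′
    ≡⟨ collect (+ n) r r′ r″ ⟩
  + suc (suc n) * (r′ + r″)                    ∎
  where
  open ≡-Reasoning
  w t t′ t″ r r′ r″ : ℤ
  w = sumBelow (suc n) T
  t  = T n
  t′ = T (suc n)
  t″ = T (2 ℕ.+ n)
  r  = R n
  r′ = R (suc n)
  r″ = R (2 ℕ.+ n)
  isolate : ∀ w t′ → + 16 * (w + t′) ≡ + 16 * w + + 4 * t′ + + 2 * (+ 6 * t′)
  isolate = solve-∀
  pair-up : ∀ w t t′ t″ r′ → + 16 * w + + 4 * t′ + + 2 * (t″ + t + r′) ≡
                             + 16 * w + (+ 2 * (t + t′) + + 2 * (t′ + t″)) + + 2 * r′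
  pair-up = solve-∀
  collect : ∀ n r r′ r″ →
    (+ 1 + n) * (r + r′) + ((+ 1 + n) * (r′ - r) + (+ 2 + n) * (r″ - r′)) + + 2 * r′ ≡ (+ 2 + n) * (r′ + r″)
  collect = solve-∀

S-closed-form : ∀ n → S (suc n) ≡ + suc n * + suc n * (R n * R n) - + 32 * (sumBelow n T * sumBelow (suc n) T)
S-closed-form zero    = refl
S-closed-form (suc n) = begin
  S (suc n) + + (2 ℕ.* suc n ℕ.+ 1) * (r′ ^ 2)
    ≡⟨ cong (λ i → i + + (2 ℕ.* suc n ℕ.+ 1) * (r′ ^ 2)) (S-closed-form n) ⟩
  N * N * (r * r) - + 32 * (w * w′) + + (2 ℕ.* suc n ℕ.+ 1) * (r′ ^ 2)
    ≡⟨ expand (+ n) r r′ w t t′ ⟩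
  closed-form + (+ 16 * w′ * (+ 2 * (t + t′)) - N * (r + r′) * (N * (r′ - r)))
    ≡⟨ cong (λ i → closed-form + i) (i≡j⇒i-j≡0 (cong₂ _*_ (sumBelow-T n) (sym (R-difference n)))) ⟩
  closed-form + + 0
    ≡⟨ +-identityʳ closed-form ⟩
  closed-form ∎
  where
  open ≡-Reasoning
  N N′ t t′ w w′ r r′ closed-form : ℤ
  N  = + suc n
  N′ = + suc (suc n)
  t  = T n
  t′ = T (suc n)
  w  = sumBelow n T
  w′ = sumBelow (suc n) T
  r  = R n
  r′ = R (suc n)
  closed-form = N′ * N′ * (r′ * r′) - + 32 * (w′ * (w′ + t′))
  expand : ∀ n r r′ w t t′ →
    (+ 1 + n) * (+ 1 + n) * (r * r) - + 32 * (w * (w + t)) + (+ 1 + n + (+ 1 + n + + 0) + + 1) * (r′ * (r′ * + 1)) ≡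
    (+ 2 + n) * (+ 2 + n) * (r′ * r′) - + 32 * ((w + t) * (w + t + t′))
      + (+ 16 * (w + t) * (+ 2 * (t + t′)) - (+ 1 + n) * (r + r′) * ((+ 1 + n) * (r′ - r)))
  expand = solve-∀

cofactor : ℕ → ℤ
cofactor n = + suc n * (R n * R n) - + 2 * ((R n + R (suc n)) * sumBelow n T)

S-factorisation : ∀ n → S (suc n) ≡ + suc n * cofactor n
S-factorisation n = begin
  S (suc n)                                       ≡⟨ S-closed-form n ⟩
  N * N * (R n * R n) - + 32 * (w * w′)           ≡⟨ regroup N (R n) w w′ ⟩
  N * N * (R n * R n) - + 2 * (+ 16 * w′ * w)
    ≡⟨ cong (λ i → N * N * (R n * R n) - + 2 * (i * w)) (sumBelow-T n) ⟩
  N * N * (R n * R n) - + 2 * (N * σ * w)         ≡⟨ factor N (R n) σ w ⟩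
  N * (N * (R n * R n) - + 2 * (σ * w))           ∎
  where
  open ≡-Reasoning
  N w w′ σ : ℤ
  N  = + suc n
  w  = sumBelow n T
  w′ = sumBelow (suc n) T
  σ  = R n + R (suc n)
  regroup : ∀ N r w w′ → N * N * (r * r) - + 32 * (w * w′) ≡ N * N * (r * r) - + 2 * (+ 16 * w′ * w)
  regroup = solve-∀
  factor : ∀ N r σ w → N * N * (r * r) - + 2 * (N * σ * w) ≡ N * (N * (r * r) - + 2 * (σ * w))
  factor = solve-∀

8*cofactor : ∀ n → + 8 * cofactor n ≡
  + 8 * (+ suc n * (R n * R n)) + (R n + R (suc n)) * (+ 8 * (+ 2 * T n) - + suc n * (R n + R (suc n)))
8*cofactor n = begin
  + 8 * (N * (R n * R n) - + 2 * (σ * w))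
    ≡⟨ regroup N (R n) σ w (T n) ⟩
  + 8 * (N * (R n * R n)) + σ * (+ 8 * (+ 2 * T n) - + 16 * (w + T n))
    ≡⟨ cong (λ i → + 8 * (N * (R n * R n)) + σ * (+ 8 * (+ 2 * T n) - i)) (sumBelow-T n) ⟩
  + 8 * (N * (R n * R n)) + σ * (+ 8 * (+ 2 * T n) - N * σ) ∎
  where
  open ≡-Reasoning
  N w σ : ℤ
  N = + suc n
  w = sumBelow n T
  σ = R n + R (suc n)
  regroup : ∀ N r σ w t →
    + 8 * (N * (r * r) - + 2 * (σ * w)) ≡ + 8 * (N * (r * r)) + σ * (+ 8 * (+ 2 * t) - + 16 * (w + t))
  regroup = solve-∀

n∣S : ∀ n → + suc n ∣ S (suc n)
n∣S n = ∣⇒∣ᵤ {+ suc n} {S (suc n)}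
  (divides (cofactor n) (trans (S-factorisation n) (*-comm (+ suc n) (cofactor n))))

R+R-via-D+D : ∀ n → (+ 2 * + suc n - + 1) * (R n + R (suc n)) ≡ + 4 * (+ suc n * R n) + (D n + D (suc n))
R+R-via-D+D n = begin
  (+ 2 * N - + 1) * (r + r′)
    ≡⟨ expand N r r′ ⟩
  + 4 * (N * r) + (+ 2 * (N * (r′ - r)) - (r + r′))
    ≡⟨ cong (λ i → + 4 * (N * r) + (+ 2 * i - (r + r′))) (R-difference n) ⟩
  + 4 * (N * r) + (+ 2 * (+ 2 * (T n + T (suc n))) - (r + r′))
    ≡⟨ distribute N r r′ (T n) (T (suc n)) ⟩
  + 4 * (N * r) + (+ 4 * T n + + 4 * T (suc n) - (r + r′))
    ≡⟨ cong₂ (λ i j → + 4 * (N * r) + (i + j - (r + r′))) (R+D≡4T n) (R+D≡4T (suc n)) ⟨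
  + 4 * (N * r) + (r + D n + (r′ + D (suc n)) - (r + r′))
    ≡⟨ cancel N r r′ (D n) (D (suc n)) ⟩
  + 4 * (N * r) + (D n + D (suc n)) ∎
  where
  open ≡-Reasoning
  N r r′ : ℤ
  N  = + suc n
  r  = R n
  r′ = R (suc n)
  expand : ∀ N r r′ → (+ 2 * N - + 1) * (r + r′) ≡ + 4 * (N * r) + (+ 2 * (N * (r′ - r)) - (r + r′))
  expand = solve-∀
  distribute : ∀ N r r′ t t′ → + 4 * (N * r) + (+ 2 * (+ 2 * (t + t′)) - (r + r′)) ≡
                               + 4 * (N * r) + (+ 4 * t + + 4 * t′ - (r + r′))
  distribute = solve-∀
  cancel : ∀ N r r′ d d′ → + 4 * (N * r) + (r + d + (r′ + d′) - (r + r′)) ≡ + 4 * (N * r) + (d + d′)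
  cancel = solve-∀

-- Terms of D and T as multiples of binom(n,j) binom(n+1+j,j)

delannoyTerm delannoyPair mixedTerm doubledTerm : ℕ → ℕ → ℤ
delannoyTerm n k = morganVoyce n k * central k
delannoyPair n k = delannoyTerm n k + delannoyTerm (suc n) k
mixedTerm    n k = binom n k * binom (suc n ℕ.+ k) k
doubledTerm  n k = + 2 * (morganVoyce n (suc k) * central k)

delannoyTerm≡binom*binom : ∀ n k → delannoyTerm n k ≡ binom n k * binom (n ℕ.+ k) k
delannoyTerm≡binom*binom n k = begin
  binom (n ℕ.+ k) (2 ℕ.* k) * binom (2 ℕ.* k) k
    ≡⟨ cong₂ (λ i j → binom i j * binom j k) (ℕ.+-comm n k) (cong (k ℕ.+_) (ℕ.+-identityʳ k)) ⟩
  binom (k ℕ.+ n) (k ℕ.+ k) * binom (k ℕ.+ k) k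
    ≡⟨ trinomial-revision k n k ⟩
  binom (k ℕ.+ n) k * binom n k
    ≡⟨ *-comm (binom (k ℕ.+ n) k) (binom n k) ⟩
  binom n k * binom (k ℕ.+ n) k
    ≡⟨ cong (λ i → binom n k * binom i k) (ℕ.+-comm k n) ⟩
  binom n k * binom (n ℕ.+ k) k ∎
  where open ≡-Reasoning

module _ (n j : ℕ) where
  open ≡-Reasoning
  private
    N K x y : ℤ
    N = + suc n
    K = + suc j
    x = binom n j
    y = binom (suc n ℕ.+ j) j

    binom[n]-suc : K * binom n (suc j) ≡ (N - K) * x
    binom[n]-suc = trans (binom-sucʳ n j) (cong (_* x) (shift (+ n) (+ j)))
      where
      shift : ∀ n k → n - k ≡ + 1 + n - (+ 1 + k)
      shift = solve-∀

    binom[n+j]-suc : K * binom (n ℕ.+ suc j) (suc j) ≡ N * y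
    binom[n+j]-suc = trans (binom-sucʳ (n ℕ.+ suc j) j)
      (cong₂ (λ c i → c * binom i j) (cancel (+ n) (+ j)) (ℕ.+-suc n j))
      where
      cancel : ∀ n j → n + (+ 1 + j) - j ≡ + 1 + n
      cancel = solve-∀

    binom[n+1+j]-suc : K * binom (suc n ℕ.+ suc j) (suc j) ≡ (N + K) * y
    binom[n+1+j]-suc = trans (binom-suc-suc (n ℕ.+ suc j) j) (cong (λ i → (N + K) * binom i j) (ℕ.+-suc n j))

    multiply-ratios : ∀ a b α β → K * a ≡ α * x → K * b ≡ β * y → K * K * (a * b) ≡ α * β * mixedTerm n j
    multiply-ratios a b α β Ka≡αx Kb≡βy = begin
      K * K * (a * b)       ≡⟨ *-interchange K K a b ⟩
      K * a * (K * b)       ≡⟨ cong₂ _*_ Ka≡αx Kb≡βy ⟩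
      α * x * (β * y)       ≡⟨ *-interchange α x β y ⟩
      α * β * (x * y)       ∎

  -- The ratio ((n+1)² - (j+1)²) / (j+1)² is congruent to -1 modulo (n+1)².
  mixedTerm-suc : K * K * mixedTerm n (suc j) ≡ (N - K) * (N + K) * mixedTerm n j
  mixedTerm-suc = multiply-ratios (binom n (suc j)) (binom (suc n ℕ.+ suc j) (suc j)) (N - K) (N + K)
    binom[n]-suc binom[n+1+j]-suc

  delannoyTerm-via-mixedTerm : K * K * delannoyTerm n (suc j) ≡ (N - K) * N * mixedTerm n j
  delannoyTerm-via-mixedTerm = trans (cong (K * K *_) (delannoyTerm≡binom*binom n (suc j)))
    (multiply-ratios (binom n (suc j)) (binom (n ℕ.+ suc j) (suc j)) (N - K) N binom[n]-suc binom[n+j]-suc)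

  delannoyTerm-suc-via-mixedTerm : K * K * delannoyTerm (suc n) (suc j) ≡ N * (N + K) * mixedTerm n j
  delannoyTerm-suc-via-mixedTerm = trans (cong (K * K *_) (delannoyTerm≡binom*binom (suc n) (suc j)))
    (multiply-ratios (binom (suc n) (suc j)) (binom (suc n ℕ.+ suc j) (suc j)) N (N + K)
      (binom-suc-suc n j) binom[n+1+j]-suc)

  delannoyPair-via-mixedTerm : K * K * delannoyPair n (suc j) ≡ + 2 * mixedTerm n j * (N * N)
  delannoyPair-via-mixedTerm = begin
    K * K * delannoyPair n (suc j)
      ≡⟨ *-distribˡ-+ (K * K) (delannoyTerm n (suc j)) _ ⟩
    K * K * delannoyTerm n (suc j) + K * K * delannoyTerm (suc n) (suc j)
      ≡⟨ cong₂ _+_ delannoyTerm-via-mixedTerm delannoyTerm-suc-via-mixedTerm ⟩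
    (N - K) * N * mixedTerm n j + N * (N + K) * mixedTerm n j
      ≡⟨ collect N K (mixedTerm n j) ⟩
    + 2 * mixedTerm n j * (N * N) ∎
    where
    collect : ∀ N K z → (N - K) * N * z + N * (N + K) * z ≡ + 2 * z * (N * N)
    collect = solve-∀

  doubledTerm-via-mixedTerm : K * (odd j * doubledTerm n j) ≡ (N - K) * N * mixedTerm n j
  doubledTerm-via-mixedTerm = begin
    K * (odd j * (+ 2 * (z * central j)))    ≡⟨ regroup K (odd j) z (central j) ⟩
    K * (z * (+ 2 * (odd j * central j)))    ≡⟨ cong (λ i → K * (z * i)) (central-suc j) ⟨
    K * (z * (K * central (suc j)))          ≡⟨ collect K z (central (suc j)) ⟩
    K * K * (z * central (suc j))            ≡⟨ delannoyTerm-via-mixedTerm ⟩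
    (N - K) * N * mixedTerm n j              ∎
    where
    z : ℤ
    z = morganVoyce n (suc j)
    regroup : ∀ k o z c → k * (o * (+ 2 * (z * c))) ≡ k * (z * (+ 2 * (o * c)))
    regroup = solve-∀
    collect : ∀ k z c → k * (z * (k * c)) ≡ k * k * (z * c)
    collect = solve-∀

D+D-sum : ∀ n → D n + D (suc n) ≡ + 2 + sumBelow (suc n) (λ j → delannoyPair n (suc j))
D+D-sum n = begin
  D n + D (suc n)
    ≡⟨ cong (_+ D (suc n)) (transform-extend central 1 n) ⟨
  sumBelow (2 ℕ.+ n) (delannoyTerm n) + D (suc n)
    ≡⟨ sumBelow-+ (2 ℕ.+ n) (delannoyTerm n) (delannoyTerm (suc n)) ⟨
  sumBelow (2 ℕ.+ n) (delannoyPair n)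
    ≡⟨ sumBelow-head (suc n) (delannoyPair n) ⟩
  + 2 + sumBelow (suc n) (λ j → delannoyPair n (suc j)) ∎
  where open ≡-Reasoning

2T-sum : ∀ n → + 2 * T n ≡ sumBelow n (doubledTerm n)
2T-sum n = begin
  + 2 * T n                                                      ≡⟨ cong (+ 2 *_) (transform-delay central 0 n) ⟨
  + 2 * sumBelow n (λ k → morganVoyce n (suc k) * central k)     ≡⟨ sumBelow-* n (+ 2) _ ⟨
  sumBelow n (doubledTerm n)                                     ∎
  where open ≡-Reasoning

module _ (m : ℕ) where
  open ≡-Reasoning
  private
    n : ℕ
    n = 2 ℕ.* m
    P K : ℤ
    P = + suc n
    K = + suc m

  doubledTerm-middle : (P + + 1) * doubledTerm n m ≡ (P - + 1) * mixedTerm n m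
  doubledTerm-middle = begin
    (P + + 1) * doubledTerm n m          ≡⟨ cong (_* doubledTerm n m) (P+1 (+ m)) ⟩
    + 2 * K * doubledTerm n m            ≡⟨ *-assoc (+ 2) K (doubledTerm n m) ⟩
    + 2 * (K * doubledTerm n m)          ≡⟨ cong (+ 2 *_) P-cancelled ⟩
    + 2 * ((P - K) * mixedTerm n m)      ≡⟨ *-assoc (+ 2) (P - K) (mixedTerm n m) ⟨
    + 2 * (P - K) * mixedTerm n m        ≡⟨ cong (_* mixedTerm n m) (P-1 (+ m)) ⟩
    (P - + 1) * mixedTerm n m            ∎
    where
    P+1 : ∀ m → + 1 + (m + (m + + 0)) + + 1 ≡ + 2 * (+ 1 + m)
    P+1 = solve-∀
    P-1 : ∀ m → + 2 * (+ 1 + (m + (m + + 0)) - (+ 1 + m)) ≡ + 1 + (m + (m + + 0)) - + 1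
    P-1 = solve-∀
    P-cancelled : K * doubledTerm n m ≡ (P - K) * mixedTerm n m
    P-cancelled = *-cancelˡ-≡ P _ _ (begin
      P * (K * doubledTerm n m)        ≡⟨ cong (_* (K * doubledTerm n m)) (pos-odd m) ⟩
      odd m * (K * doubledTerm n m)    ≡⟨ x∙yz≈y∙xz (odd m) K (doubledTerm n m) ⟩
      K * (odd m * doubledTerm n m)    ≡⟨ doubledTerm-via-mixedTerm n m ⟩
      (P - K) * P * mixedTerm n m      ≡⟨ xy∙z≈y∙xz (P - K) P (mixedTerm n m) ⟩
      P * ((P - K) * mixedTerm n m)    ∎)

-- Congruences modulo powers of a prime p = n + 1

module _ {n : ℕ} (p-prime : Prime (suc n)) where
  private
    P : ℤ
    P = + suc n

  coprime-suc : ∀ {j} → j ℕ.< n → Coprime P (+ suc j)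
  coprime-suc j<n = ℕ.prime⇒coprime p-prime (s≤s j<n)

  coprime²-suc : ∀ {j} → j ℕ.< n → Coprime (P * P) (+ suc j)
  coprime²-suc {j} j<n = coprime-*ˡ P P (+ suc j) (coprime-suc j<n) (coprime-suc j<n)

  coprime²-suc² : ∀ {j} → j ℕ.< n → Coprime (P * P) (+ suc j * + suc j)
  coprime²-suc² {j} j<n = coprime-*ʳ (P * P) (+ suc j) (+ suc j) (coprime²-suc j<n) (coprime²-suc j<n)

  mixedTerm-mod-p² : ∀ {j} → j ℕ.≤ n → mixedTerm n j ≈ altSign j mod P * P
  mixedTerm-mod-p² {zero}  _   = ≈-refl
  mixedTerm-mod-p² {suc j} j<n = ≈-cancelˡ (K * K) (coprime²-suc² j<n) (begin
    K * K * mixedTerm n (suc j)              ≡⟨ mixedTerm-suc n j ⟩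
    (P - K) * (P + K) * mixedTerm n j        ≈⟨ congruent (mixedTerm n j) (expand P K (mixedTerm n j)) ⟩
    - (K * K) * mixedTerm n j                ≈⟨ *-congˡ (- (K * K)) (mixedTerm-mod-p² (ℕ.<⇒≤ j<n)) ⟩
    - (K * K) * altSign j                    ≡⟨ move-sign K (altSign j) ⟩
    K * K * altSign (suc j)                  ∎)
    where
    open ≈-Reasoning (P * P)
    K : ℤ
    K = + suc j
    expand : ∀ p k x → (p - k) * (p + k) * x ≡ - (k * k) * x + x * (p * p)
    expand = solve-∀
    move-sign : ∀ k s → - (k * k) * s ≡ k * k * (-[1+ 0 ] * s)
    move-sign = solve-∀

  D-mod-p : D n ≈ + 1 mod P
  D-mod-p = begin
    D n                                                ≡⟨ sumBelow-head n (delannoyTerm n) ⟩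
    + 1 + sumBelow n (λ j → delannoyTerm n (suc j))    ≈⟨ +-congˡ (+ 1) (sumBelow-≈0 n term≈0) ⟩
    + 1                                                ∎
    where
    open ≈-Reasoning P
    factor : ∀ p k x → (p - k) * p * x ≡ k * k * + 0 + (p - k) * x * p
    factor = solve-∀
    term≈0 : ∀ {j} → j ℕ.< n → delannoyTerm n (suc j) ≈ + 0 mod P
    term≈0 {j} j<n = ≈-cancelˡ (K * K) (coprime-*ʳ P K K (coprime-suc j<n) (coprime-suc j<n)) (begin
      K * K * delannoyTerm n (suc j)     ≡⟨ delannoyTerm-via-mixedTerm n j ⟩
      (P - K) * P * mixedTerm n j        ≈⟨ congruent ((P - K) * mixedTerm n j) (factor P K (mixedTerm n j)) ⟩
      K * K * + 0                        ∎)
      where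
      K : ℤ
      K = + suc j

  D+D-mod-p² : D n + D (suc n) ≈ + 2 + + 2 * altSign n mod P * P
  D+D-mod-p² = begin
    D n + D (suc n)
      ≡⟨ D+D-sum n ⟩
    + 2 + (sumBelow n (λ j → delannoyPair n (suc j)) + delannoyPair n (suc n))
      ≈⟨ +-congˡ (+ 2) (+-cong (sumBelow-≈0 n pair≈0) last-pair≈) ⟩
    + 2 + (+ 0 + + 2 * altSign n)
      ≡⟨ cong (λ i → + 2 + i) (+-identityˡ (+ 2 * altSign n)) ⟩
    + 2 + + 2 * altSign n ∎
    where
    open ≈-Reasoning (P * P)
    pad : ∀ k x m → x * m ≡ k * k * + 0 + x * m
    pad = solve-∀
    pair≈0 : ∀ {j} → j ℕ.< n → delannoyPair n (suc j) ≈ + 0 mod P * P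
    pair≈0 {j} j<n = ≈-cancelˡ (K * K) (coprime²-suc² j<n) (begin
      K * K * delannoyPair n (suc j)     ≡⟨ delannoyPair-via-mixedTerm n j ⟩
      + 2 * mixedTerm n j * (P * P)      ≈⟨ congruent (+ 2 * mixedTerm n j) (pad K (+ 2 * mixedTerm n j) (P * P)) ⟩
      K * K * + 0                        ∎)
      where
      K : ℤ
      K = + suc j
    last-pair : delannoyPair n (suc n) ≡ + 2 * mixedTerm n n
    last-pair = *-cancelˡ-≡ (P * P) _ _
      (trans (delannoyPair-via-mixedTerm n n) (*-comm (+ 2 * mixedTerm n n) (P * P)))
    last-pair≈ : delannoyPair n (suc n) ≈ + 2 * altSign n mod P * P
    last-pair≈ = begin
      delannoyPair n (suc n)     ≡⟨ last-pair ⟩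
      + 2 * mixedTerm n n        ≈⟨ *-congˡ (+ 2) (mixedTerm-mod-p² ℕ.≤-refl) ⟩
      + 2 * altSign n            ∎

  doubledTerm-mod-p² : ∀ {j} → j ℕ.< n → odd j * doubledTerm n j ≈ - (P * altSign j) mod P * P
  doubledTerm-mod-p² {j} j<n = ≈-cancelˡ K (coprime²-suc j<n) (begin
    K * (odd j * doubledTerm n j)    ≡⟨ doubledTerm-via-mixedTerm n j ⟩
    (P - K) * P * mixedTerm n j      ≈⟨ congruent (mixedTerm n j) (expand P K (mixedTerm n j)) ⟩
    - (K * P) * mixedTerm n j        ≈⟨ *-congˡ (- (K * P)) (mixedTerm-mod-p² (ℕ.<⇒≤ j<n)) ⟩
    - (K * P) * altSign j            ≡⟨ move-sign K P (altSign j) ⟩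
    K * - (P * altSign j)            ∎)
    where
    open ≈-Reasoning (P * P)
    K : ℤ
    K = + suc j
    expand : ∀ p k x → (p - k) * p * x ≡ - (k * p) * x + x * (p * p)
    expand = solve-∀
    move-sign : ∀ k p s → - (k * p) * s ≡ k * - (p * s)
    move-sign = solve-∀

module _ (m′ : ℕ) (p-prime : Prime (suc (2 ℕ.* suc m′))) where
  private
    m n : ℕ
    m = suc m′
    n = 2 ℕ.* m
    P ε : ℤ
    P = + suc n
    ε = altSign m

    m<n : m ℕ.< n
    m<n = ℕ.m<m+n m (s≤s z≤n)

  doubledTerm-head-mod-p² : doubledTerm n 0 ≈ - P mod P * P
  doubledTerm-head-mod-p² = begin
    doubledTerm n 0          ≡⟨ *-identityˡ (doubledTerm n 0) ⟨
    + 1 * doubledTerm n 0    ≈⟨ doubledTerm-mod-p² p-prime (s≤s z≤n) ⟩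
    - (P * + 1)              ≡⟨ cong -_ (*-identityʳ P) ⟩
    - P                      ∎
    where open ≈-Reasoning (P * P)

  doubledTerm-middle-mod-p² : doubledTerm n m ≈ (+ 2 * P - + 1) * ε mod P * P
  doubledTerm-middle-mod-p² = begin
    δ                                            ≈⟨ congruent δ (invert P δ) ⟩
    (+ 1 - P) * ((P + + 1) * δ)                  ≡⟨ cong ((+ 1 - P) *_) (doubledTerm-middle m) ⟩
    (+ 1 - P) * ((P - + 1) * mixedTerm n m)
      ≈⟨ *-congˡ (+ 1 - P) (*-congˡ (P - + 1) (mixedTerm-mod-p² p-prime (ℕ.<⇒≤ m<n))) ⟩
    (+ 1 - P) * ((P - + 1) * ε)                  ≈⟨ congruent (- ε) (expand P ε) ⟩
    (+ 2 * P - + 1) * ε                          ∎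
    where
    open ≈-Reasoning (P * P)
    δ : ℤ
    δ = doubledTerm n m
    invert : ∀ p x → x ≡ (+ 1 - p) * ((p + + 1) * x) + x * (p * p)
    invert = solve-∀
    expand : ∀ p s → (+ 1 - p) * ((p - + 1) * s) ≡ (+ 2 * p - + 1) * s + - s * (p * p)
    expand = solve-∀

  doubledTerm-pair-mod-p² : ∀ i j → i ℕ.+ j ≡ n → 0 ℕ.< i → i ℕ.< m →
                            doubledTerm n i + doubledTerm n j ≈ + 0 mod P * P
  doubledTerm-pair-mod-p² i j i+j≡n 0<i i<m =
    opposite-denominators-cancel P (odd i) (odd j) (altSign i) (doubledTerm n i) (doubledTerm n j)
      (subst (Coprime P) (pos-odd i) (coprime-suc p-prime (ℕ.*-monoʳ-< 2 i<m)))
      odd+odd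
      (doubledTerm-mod-p² p-prime (ℕ.<-trans i<m m<n))
      (subst (λ s → odd j * doubledTerm n j ≈ - (P * s) mod P * P) (sym (altSign-reflect i j m i+j≡n))
        (doubledTerm-mod-p² p-prime (subst (j ℕ.<_) i+j≡n (ℕ.m<n+m j 0<i))))
    where
    open ≡-Reasoning
    collect : ∀ i j → + 1 + + 2 * i + (+ 1 + + 2 * j) ≡ + 2 * (+ 1 + (i + j))
    collect = solve-∀
    odd+odd : odd i + odd j ≡ + 2 * P
    odd+odd = begin
      odd i + odd j              ≡⟨ collect (+ i) (+ j) ⟩
      + 2 * + suc (i ℕ.+ j)      ≡⟨ cong (λ k → + 2 * + suc k) i+j≡n ⟩
      + 2 * P                    ∎

  2T-mod-p² : + 2 * T n ≈ (+ 2 * P - + 1) * ε - P mod P * P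
  2T-mod-p² = begin
    + 2 * T n                                      ≡⟨ 2T-sum n ⟩
    sumBelow n (doubledTerm n)                     ≡⟨ cong (λ k → sumBelow k (doubledTerm n)) n≡2+2m′ ⟩
    sumBelow (2 ℕ.+ 2 ℕ.* m′) (doubledTerm n)      ≡⟨ sumBelow-head (suc (2 ℕ.* m′)) (doubledTerm n) ⟩
    doubledTerm n 0 + sumBelow (suc (2 ℕ.* m′)) (λ k → doubledTerm n (suc k))
      ≈⟨ +-cong doubledTerm-head-mod-p² (sumBelow-pairs-cancel m′ (λ k → doubledTerm n (suc k)) pair≈0) ⟩
    - P + doubledTerm n m                          ≈⟨ +-congˡ (- P) doubledTerm-middle-mod-p² ⟩
    - P + (+ 2 * P - + 1) * ε                      ≡⟨ +-comm (- P) ((+ 2 * P - + 1) * ε) ⟩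
    (+ 2 * P - + 1) * ε - P                        ∎
    where
    open ≈-Reasoning (P * P)
    n≡2+2m′ : n ≡ 2 ℕ.+ 2 ℕ.* m′
    n≡2+2m′ = ℕ.*-suc 2 m′
    pair≈0 : ∀ i j → i ℕ.+ j ≡ 2 ℕ.* m′ → i ℕ.< m′ → doubledTerm n (suc i) + doubledTerm n (suc j) ≈ + 0 mod P * P
    pair≈0 i j i+j≡2m′ i<m′ = doubledTerm-pair-mod-p² (suc i) (suc j)
      (trans (cong suc (trans (ℕ.+-suc i j) (cong suc i+j≡2m′))) (sym n≡2+2m′)) (s≤s z≤n) (s≤s i<m′)

  R-mod-p : R n ≈ - (+ 1 + + 2 * ε) mod P
  R-mod-p = begin
    R n                                           ≡⟨ add-subtract (R n) (D n) ⟩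
    R n + D n - D n                               ≡⟨ cong (_- D n) (trans (R+D≡4T n) (*-assoc (+ 2) (+ 2) (T n))) ⟩
    + 2 * (+ 2 * T n) - D n
      ≈⟨ +-cong (*-congˡ (+ 2) (≈-weaken P 2T-mod-p²)) (-‿cong (D-mod-p p-prime)) ⟩
    + 2 * ((+ 2 * P - + 1) * ε - P) - + 1         ≈⟨ congruent (+ 4 * ε - + 2) (expand P ε) ⟩
    - (+ 1 + + 2 * ε)                             ∎
    where
    open ≈-Reasoning P
    add-subtract : ∀ r d → r ≡ r + d - d
    add-subtract = solve-∀
    expand : ∀ p s → + 2 * ((+ 2 * p - + 1) * s - p) - + 1 ≡ - (+ 1 + + 2 * s) + (+ 4 * s - + 2) * p
    expand = solve-∀

  R+R-mod-p² : R n + R (suc n) ≈ + 4 * (+ 2 * P * ε - P - + 1) mod P * P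
  R+R-mod-p² = begin
    σ                                             ≈⟨ congruent (+ 4 * σ) (invert P σ) ⟩
    c * ((+ 2 * P - + 1) * σ)                     ≡⟨ cong (c *_) (R+R-via-D+D n) ⟩
    c * (+ 4 * (P * R n) + (D n + D (suc n)))     ≈⟨ *-congˡ c (+-cong (*-congˡ (+ 4) (≈-scale P R-mod-p)) D+D≈4) ⟩
    c * (+ 4 * (P * - (+ 1 + + 2 * ε)) + + 4)     ≈⟨ congruent (+ 8 * (+ 1 + + 2 * ε)) (expand P ε) ⟩
    + 4 * (+ 2 * P * ε - P - + 1)                 ∎
    where
    open ≈-Reasoning (P * P)
    σ c : ℤ
    σ = R n + R (suc n)
    c = - (+ 1 + + 2 * P)
    D+D≈4 : D n + D (suc n) ≈ + 4 mod P * P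
    D+D≈4 = subst (λ s → D n + D (suc n) ≈ + 2 + + 2 * s mod P * P) (altSign-double m) (D+D-mod-p² p-prime)
    invert : ∀ p x → x ≡ - (+ 1 + + 2 * p) * ((+ 2 * p - + 1) * x) + + 4 * x * (p * p)
    invert = solve-∀
    expand : ∀ p s → - (+ 1 + + 2 * p) * (+ 4 * (p * - (+ 1 + + 2 * s)) + + 4) ≡
                     + 4 * (+ 2 * p * s - p - + 1) + + 8 * (+ 1 + + 2 * s) * (p * p)
    expand = solve-∀

  cofactor-mod-p² : cofactor n ≈ + 4 * ε - P mod P * P
  cofactor-mod-p² = ≈-cancelˡ (+ 8) (coprime-*ˡ P P (+ 8) p⊥8 p⊥8) (begin
    + 8 * cofactor n
      ≡⟨ 8*cofactor n ⟩
    + 8 * (P * (R n * R n)) + σ * (+ 8 * (+ 2 * T n) - P * σ)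
      ≈⟨ +-cong (*-congˡ (+ 8) (≈-scale P (*-cong R-mod-p R-mod-p)))
           (*-cong R+R-mod-p² (+-cong (*-congˡ (+ 8) 2T-mod-p²) (-‿cong (*-congˡ P R+R-mod-p²)))) ⟩
    + 8 * (P * (r * r)) + s * (+ 8 * ((+ 2 * P - + 1) * ε - P) - P * s)
      ≈⟨ congruent (+ 16 * (+ 2 * ε - + 1) * (+ 4 * ε - P * (+ 2 * ε - + 1))) (expand P ε) ⟩
    + 32 * ε + + 24 * P - + 32 * P * (ε * ε)
      ≡⟨ cong (λ i → + 32 * ε + + 24 * P - + 32 * P * i) (altSign-square m) ⟩
    + 32 * ε + + 24 * P - + 32 * P * + 1
      ≡⟨ factor P ε ⟩
    + 8 * (+ 4 * ε - P) ∎)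
    where
    open ≈-Reasoning (P * P)
    σ r s : ℤ
    σ = R n + R (suc n)
    r = - (+ 1 + + 2 * ε)
    s = + 4 * (+ 2 * P * ε - P - + 1)
    p⊥2 : Coprime P (+ 2)
    p⊥2 = coprime-suc p-prime (ℕ.≤-trans (s≤s (s≤s z≤n)) m<n)
    p⊥8 : Coprime P (+ 8)
    p⊥8 = coprime-*ʳ P (+ 2) (+ 4) p⊥2 (coprime-*ʳ P (+ 2) (+ 2) p⊥2 p⊥2)
    expand : ∀ p ε →
      + 8 * (p * (- (+ 1 + + 2 * ε) * - (+ 1 + + 2 * ε)))
        + + 4 * (+ 2 * p * ε - p - + 1)
          * (+ 8 * ((+ 2 * p - + 1) * ε - p) - p * (+ 4 * (+ 2 * p * ε - p - + 1))) ≡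
      + 32 * ε + + 24 * p - + 32 * p * (ε * ε)
        + + 16 * (+ 2 * ε - + 1) * (+ 4 * ε - p * (+ 2 * ε - + 1)) * (p * p)
    expand = solve-∀
    factor : ∀ p ε → + 32 * ε + + 24 * p - + 32 * p * + 1 ≡ + 8 * (+ 4 * ε - p)
    factor = solve-∀

  S-mod-p³ : S (suc n) ≈ + 4 * P * ε - P ^ 2 mod P ^ 3
  S-mod-p³ = subst (λ i → S (suc n) ≈ + 4 * P * ε - P ^ 2 mod i) (cube P) (begin
    S (suc n)               ≡⟨ S-factorisation n ⟩
    P * cofactor n          ≈⟨ ≈-scale P cofactor-mod-p² ⟩
    P * (+ 4 * ε - P)       ≡⟨ distribute P ε ⟩
    + 4 * P * ε - P ^ 2     ∎)
    where
    open ≈-Reasoning (P * (P * P))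
    cube : ∀ p → p * (p * p) ≡ p * (p * (p * + 1))
    cube = solve-∀
    distribute : ∀ p ε → p * (+ 4 * ε - p) ≡ + 4 * p * ε - p * (p * + 1)
    distribute = solve-∀

odd-prime : ∀ {p} → Prime p → p ≢ 2 → ∃ λ m → p ≡ suc (2 ℕ.* suc m)
odd-prime {p} p-prime p≢2 with p ℕ.% 2 | p ℕ./ 2 | m≡m%n+[m/n]*n p 2 | m%n<n p 2
... | 1 | suc m | p≡1+[1+m]*2 | _ = m , trans p≡1+[1+m]*2 (cong suc (ℕ.*-comm (suc m) 2))
... | 1 | zero  | refl        | _ = contradiction p-prime ¬prime[1]
... | suc (suc _) | _ | _     | s≤s (s≤s ())
... | 0 | h     | p≡h*2       | _ with prime⇒irreducible p-prime (ℕ.divides h p≡h*2)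
...   | inj₂ 2≡p = contradiction (sym 2≡p) p≢2

theorem1p1 : (∀ (n : ℕ) → 1 ℕ.≤ n →
                 (+ n) ∣ sumBelow n (λ k → + (2 ℕ.* k ℕ.+ 1) * (R k ^ 2)))
             × (∀ (p : ℕ) → Prime p → p ≢ 2 →
                 ((+ p) ^ 3) ∣ (sumBelow p (λ k → + (2 ℕ.* k ℕ.+ 1) * (R k ^ 2))
                              - (((+ 4) * (+ p) * (-[1+ 0 ] ^ ((p ∸ 1) ℕ./ 2))) - ((+ p) ^ 2))))
theorem1p1 = divisibility , congruence
  where
  divisibility : ∀ n → 1 ℕ.≤ n → + n ∣ S n
  divisibility (suc n) _ = n∣S n
  congruence : ∀ p → Prime p → p ≢ 2 → (+ p) ^ 3 ∣ S p - (+ 4 * + p * altSign ((p ∸ 1) ℕ./ 2) - (+ p) ^ 2)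
  congruence p p-prime p≢2 with m , refl ← odd-prime p-prime p≢2 =
    subst (λ h → (+ p) ^ 3 ∣ S p - (+ 4 * + p * altSign h - (+ p) ^ 2)) (sym half) (≈⇒∣- (S-mod-p³ m p-prime))
    where
    half : (2 ℕ.* suc m) ℕ./ 2 ≡ suc m
    half = trans (cong (ℕ._/ 2) (ℕ.*-comm 2 (suc m))) (m*n/n≡m (suc m) 2)
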